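{- Let $G$ be a nontrivial finite abelian group, let $m\ge 1$ be an integer, and let $E: a_1x_1+\dots+a_{2m+1}x_{2m+1}=0$ be a linear equation with coefficients $a_i\in\mathbb{Z}\setminus\{0\}$ for $i=1,\dots,2m+1$, such that $|G|$ is coprime to $a_i$ for every $i=1,\dots,2m+1$. Then $E$ is $r$-uncommon over $G$ for every integer $r\ge 3$.
   Context: Let $G$ be a finite abelian group and $E: a_1x_1+\dots+a_kx_k=0$ a linear equation with nonzero integer coefficients (integers act on $G$ by repeated addition). Let $\mathcal{C}(E)=\{v\in G^k: a_1v_1+\dots+a_kv_k=0\}$. A (probabilistic) $r$-coloring of $G$ is a tuple of functions $f_1,\dots,f_r: G\to[0,1]$ with $f_1(t)+\dots+f_r(t)=1$ for every $t\in G$, where $f_j(t)$ is regarded as the probability that $t$ receives color $j$. The (expected) proportion of monochromatic solutions of $E$ in $G$ for this coloring is $$\mu_E(f_1,\dots,f_r)=\frac{1}{|\mathcal{C}(E)|}\sum_{v\in\mathcal{C}(E)}\ \sum_{j=1}^{r}\ \prod_{i=1}^{k} f_j(v_i).$$ The uniformly random coloring, $f_1=\dots=f_r=1/r$, has $\mu_E=r^{1-k}$. The equation $E$ is called $r$-common over $G$ if $\mu_E(f_1,\dots,f_r)\ge r^{1-k}$ for every $r$-coloring $(f_1,\dots,f_r)$ of $G$, and $r$-uncommon over $G$ otherwise, i.e. if some $r$-coloring $(f_1,\dots,f_r)$ satisfies $\mu_E(f_1,\dots,f_r)<r^{1-k}$. -}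

module Defs where

open import Algebra.Bundles using (AbelianGroup; RawSemiring)
import Algebra.Definitions.RawMonoid as RawMonoidDefs
import Algebra.Definitions.RawSemiring as RawSemiringDefs
import Algebra.Properties.Group as GroupProperties
open import Data.Fin.Base using (Fin; zero; suc)
import Data.Fin.Properties as Fin
open import Data.Integer.Base as ℤ using (ℤ; +_; -[1+_])
open import Data.List.Base as List using (List; length; filter; cartesianProductWith)
open import Data.List.Membership.Propositional using (_∈_; find)
open import Data.List.Membership.Propositional.Properties using (∈-filter⁺)
open import Data.List.Relation.Unary.Any using (Any; here; there)
import Data.List.Relation.Unary.Any.Properties as Any
open import Data.Nat.Base as ℕ using (ℕ; zero; suc; NonZero; _^_; _⊔_)
import Data.Nat.Properties as ℕ
open import Data.Product.Base using (Σ-syntax; ∃-syntax; _×_; _,_)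
open import Data.Rational.Base as ℚ using (ℚ; 0ℚ; 1ℚ; ½; ∣_∣; _/_)
import Data.Rational.Properties as ℚ
open import Data.Rational.Solver using (module +-*-Solver)
open import Data.Vec.Functional as Vector using (Vector; _∷_)
open import Function.Bundles using (Inverse)
open import Function.Properties.Inverse using (Inverse⇒Injection)
import Function.Construct.Symmetry as Symmetry
open import Level using (Level; 0ℓ) renaming (_⊔_ to _⊔ˡ_; suc to lsuc)
open import Relation.Binary.Definitions using (Decidable)
open import Relation.Binary.PropositionalEquality
  using (_≡_; refl; sym; cong; subst; module ≡-Reasoning) renaming (setoid to ≡-setoid)
open import Relation.Nullary.Decidable using (Dec; via-injection)
open import Relation.Nullary.Negation using (¬_)

private
  variable
    c ℓ : Level
    r k : ℕ

-- The standard library has no real numbers: a real is a Cauchy sequence of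
-- rationals, taken up to the equivalence _≃_.

Eventually : (ℕ → Set) → Set
Eventually P = ∃[ N ] (∀ n → N ℕ.≤ n → P n)

IsCauchy : (ℕ → ℚ) → Set
IsCauchy x = ∀ ε → 0ℚ ℚ.< ε →
  ∃[ N ] (∀ m n → N ℕ.≤ m → N ℕ.≤ n → ∣ x m ℚ.- x n ∣ ℚ.≤ ε)

record ℝ : Set where
  constructor mkℝ
  field
    seq    : ℕ → ℚ
    cauchy : IsCauchy seq

open ℝ public

infix 4 _≃_ _≤_ _<_
infixl 6 _+_
infixl 7 _*_

_≃_ : ℝ → ℝ → Set
x ≃ y = ∀ ε → 0ℚ ℚ.< ε → Eventually (λ n → ∣ seq x n ℚ.- seq y n ∣ ℚ.≤ ε)

_≤_ : ℝ → ℝ → Set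
x ≤ y = ∀ ε → 0ℚ ℚ.< ε → Eventually (λ n → seq x n ℚ.≤ seq y n ℚ.+ ε)

_<_ : ℝ → ℝ → Set
x < y = ∃[ ε ] (0ℚ ℚ.< ε × Eventually (λ n → seq x n ℚ.+ ε ℚ.≤ seq y n))

private
  open +-*-Solver using (solve; _:+_; _:-_; _:*_; _:=_; con)

  half : ∀ {ε} → 0ℚ ℚ.< ε → 0ℚ ℚ.< ½ ℚ.* ε
  half {ε} 0<ε = ℚ.positive⁻¹ (½ ℚ.* ε)
    {{ℚ.pos*pos⇒pos ½ ε {{ℚ.positive 0<ε}}}}

  half+half : ∀ ε → ½ ℚ.* ε ℚ.+ ½ ℚ.* ε ≡ ε
  half+half = solve 1 (λ e → con ½ :* e :+ con ½ :* e := e) refl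

  +-difference : ∀ a b c d → (a ℚ.+ b) ℚ.- (c ℚ.+ d) ≡ (a ℚ.- c) ℚ.+ (b ℚ.- d)
  +-difference = solve 4 (λ a b c d → (a :+ b) :- (c :+ d) := (a :- c) :+ (b :- d)) refl

  *-difference : ∀ a b c d → a ℚ.* b ℚ.- c ℚ.* d ≡ a ℚ.* (b ℚ.- d) ℚ.+ d ℚ.* (a ℚ.- c)
  *-difference = solve 4 (λ a b c d → a :* b :- c :* d := a :* (b :- d) :+ d :* (a :- c)) refl

  split : ∀ a b → a ≡ (a ℚ.- b) ℚ.+ b
  split = solve 2 (λ a b → a := (a :- b) :+ b) refl

  triangle : ∀ {p} q r {α β γ} → p ≡ q ℚ.+ r → α ℚ.+ β ≡ γ →
    ∣ q ∣ ℚ.≤ α → ∣ r ∣ ℚ.≤ β → ∣ p ∣ ℚ.≤ γ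
  triangle q r refl refl q≤α r≤β = ℚ.≤-trans (ℚ.∣p+q∣≤∣p∣+∣q∣ q r) (ℚ.+-mono-≤ q≤α r≤β)

  +-cauchy : ∀ {x y} → IsCauchy x → IsCauchy y → IsCauchy (λ n → x n ℚ.+ y n)
  +-cauchy {x} {y} cx cy ε 0<ε =
    let M , hx = cx (½ ℚ.* ε) (half 0<ε)
        N , hy = cy (½ ℚ.* ε) (half 0<ε)
    in M ⊔ N , λ m n ≤m ≤n →
      triangle (x m ℚ.- x n) (y m ℚ.- y n)
        (+-difference (x m) (y m) (x n) (y n)) (half+half ε)
        (hx m n (ℕ.m⊔n≤o⇒m≤o M N ≤m) (ℕ.m⊔n≤o⇒m≤o M N ≤n))
        (hy m n (ℕ.m⊔n≤o⇒n≤o M N ≤m) (ℕ.m⊔n≤o⇒n≤o M N ≤n))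

  bounded : ∀ {x} → IsCauchy x →
    ∃[ B ] (ℚ.Positive B × Eventually (λ n → ∣ x n ∣ ℚ.≤ B))
  bounded {x} cx =
    let N , h = cx 1ℚ (ℚ.positive⁻¹ 1ℚ)
    in 1ℚ ℚ.+ ∣ x N ∣
      , ℚ.pos+nonNeg⇒pos 1ℚ ∣ x N ∣ {{ℚ.∣-∣-nonNeg (x N)}}
      , N , λ n N≤n →
          triangle (x n ℚ.- x N) (x N) (split (x n) (x N)) refl (h n N N≤n ℕ.≤-refl) ℚ.≤-refl

  cancel : ∀ B .{{_ : ℚ.NonZero B}} e → B ℚ.* (ℚ.1/ B ℚ.* e) ≡ e
  cancel B e = begin
    B ℚ.* (ℚ.1/ B ℚ.* e)  ≡⟨ ℚ.*-assoc B (ℚ.1/ B) e ⟨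
    (B ℚ.* ℚ.1/ B) ℚ.* e  ≡⟨ cong (ℚ._* e) (ℚ.*-inverseʳ B) ⟩
    1ℚ ℚ.* e              ≡⟨ ℚ.*-identityˡ e ⟩
    e ∎
    where open ≡-Reasoning

  scaled : ∀ B → ℚ.Positive B → ∀ e → 0ℚ ℚ.< e → ∃[ δ ] (0ℚ ℚ.< δ × B ℚ.* δ ≡ e)
  scaled B B>0 e 0<e = ℚ.1/ B ℚ.* e
    , ℚ.positive⁻¹ (ℚ.1/ B ℚ.* e)
        {{ℚ.pos*pos⇒pos (ℚ.1/ B) {{ℚ.1/pos⇒pos B}} e {{ℚ.positive 0<e}}}}
    , cancel B e
    where
    instance
      _ = B>0
      _ = ℚ.pos⇒nonZero B

  *-mono-∣∣ : ∀ p q {B δ e} → ℚ.Positive B → B ℚ.* δ ≡ e →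
    ∣ p ∣ ℚ.≤ B → ∣ q ∣ ℚ.≤ δ → ∣ p ℚ.* q ∣ ℚ.≤ e
  *-mono-∣∣ p q {B} {δ} B>0 refl p≤B q≤δ =
    subst (ℚ._≤ B ℚ.* δ) (sym (ℚ.∣p*q∣≡∣p∣*∣q∣ p q))
      (ℚ.≤-trans (ℚ.*-monoʳ-≤-nonNeg ∣ q ∣ {{ℚ.∣-∣-nonNeg q}} p≤B)
                 (ℚ.*-monoˡ-≤-nonNeg B {{ℚ.pos⇒nonNeg B {{B>0}}}} q≤δ))

  *-cauchy : ∀ {x y} → IsCauchy x → IsCauchy y → IsCauchy (λ n → x n ℚ.* y n)
  *-cauchy {x} {y} cx cy ε 0<ε =
    let A , A>0 , M₁ , x≤A = bounded {x} cx
        B , B>0 , M₂ , y≤B = bounded {y} cy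
        δ , 0<δ , Aδ = scaled A A>0 (½ ℚ.* ε) (half 0<ε)
        η , 0<η , Bη = scaled B B>0 (½ ℚ.* ε) (half 0<ε)
        N₁ , hy = cy δ 0<δ
        N₂ , hx = cx η 0<η
        M    = M₁ ⊔ M₂
        N    = N₁ ⊔ N₂
        M₁≤ = ℕ.≤-trans (ℕ.m≤m⊔n M₁ M₂) (ℕ.m≤m⊔n M N)
        M₂≤ = ℕ.≤-trans (ℕ.m≤n⊔m M₁ M₂) (ℕ.m≤m⊔n M N)
        N₁≤ = ℕ.≤-trans (ℕ.m≤m⊔n N₁ N₂) (ℕ.m≤n⊔m M N)
        N₂≤ = ℕ.≤-trans (ℕ.m≤n⊔m N₁ N₂) (ℕ.m≤n⊔m M N)
    in M ⊔ N , λ m n ≤m ≤n →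
      triangle (x m ℚ.* (y m ℚ.- y n)) (y n ℚ.* (x m ℚ.- x n))
        (*-difference (x m) (y m) (x n) (y n)) (half+half ε)
        (*-mono-∣∣ (x m) (y m ℚ.- y n) A>0 Aδ
          (x≤A m (ℕ.≤-trans M₁≤ ≤m)) (hy m n (ℕ.≤-trans N₁≤ ≤m) (ℕ.≤-trans N₁≤ ≤n)))
        (*-mono-∣∣ (y n) (x m ℚ.- x n) B>0 Bη
          (y≤B n (ℕ.≤-trans M₂≤ ≤n)) (hx m n (ℕ.≤-trans N₂≤ ≤m) (ℕ.≤-trans N₂≤ ≤n)))

fromℚ : ℚ → ℝ
fromℚ q = mkℝ (λ _ → q) λ ε 0<ε → 0 , λ _ _ _ _ →
  subst (λ d → ∣ d ∣ ℚ.≤ ε) (sym (ℚ.+-inverseʳ q)) (ℚ.<⇒≤ 0<ε)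

0ℝ 1ℝ : ℝ
0ℝ = fromℚ 0ℚ
1ℝ = fromℚ 1ℚ

_+_ : ℝ → ℝ → ℝ
mkℝ x cx + mkℝ y cy = mkℝ (λ n → x n ℚ.+ y n) (+-cauchy {x} {y} cx cy)

_*_ : ℝ → ℝ → ℝ
mkℝ x cx * mkℝ y cy = mkℝ (λ n → x n ℚ.* y n) (*-cauchy {x} {y} cx cy)

ℝ-rawSemiring : RawSemiring 0ℓ 0ℓ
ℝ-rawSemiring = record
  { Carrier = ℝ ; _≈_ = _≃_ ; _+_ = _+_ ; _*_ = _*_ ; 0# = 0ℝ ; 1# = 1ℝ }

open RawSemiringDefs ℝ-rawSemiring public using (sum; product)

record FiniteAbelianGroup c ℓ : Set (lsuc (c ⊔ˡ ℓ)) where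
  field
    abelianGroup : AbelianGroup c ℓ
    order        : ℕ
    enumeration  : Inverse (≡-setoid (Fin order)) (AbelianGroup.setoid abelianGroup)

  open AbelianGroup abelianGroup public
  open RawMonoidDefs rawMonoid public
    using () renaming (sum to sumᴳ; _×_ to _×ᴳ_)

  infixr 8 _·_

  _·_ : ℤ → Carrier → Carrier
  (+ n)    · x = n ×ᴳ x
  -[1+ n ] · x = (suc n ×ᴳ x) ⁻¹

  -- One representative of each ≈-class, without repetition.
  elements : List Carrier
  elements = List.tabulate (Inverse.to enumeration)

  _≟_ : Decidable _≈_
  _≟_ = via-injection (Inverse⇒Injection (Symmetry.inverse enumeration)) Fin._≟_

Nontrivial : FiniteAbelianGroup c ℓ → Set (c ⊔ˡ ℓ)
Nontrivial G = ∃[ x ] ¬ (x ≈ ε)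
  where open FiniteAbelianGroup G

tuples : ∀ {a} {A : Set a} → List A → (k : ℕ) → List (Vector A k)
tuples xs zero    = List.[ Vector.[] ]
tuples xs (suc k) = cartesianProductWith _∷_ xs (tuples xs k)

-- An equation a₁x₁ + ⋯ + aₖxₖ = 0 is given by its coefficient vector a.
module _ (G : FiniteAbelianGroup c ℓ) {k : ℕ} (a : Vector ℤ k) where
  open FiniteAbelianGroup G hiding (sym)

  IsSolution : Vector Carrier k → Set ℓ
  IsSolution v = sumᴳ (λ i → a i · v i) ≈ ε

  isSolution? : ∀ v → Dec (IsSolution v)
  isSolution? v = sumᴳ (λ i → a i · v i) ≟ ε

  solutions : List (Vector Carrier k)
  solutions = filter isSolution? (tuples elements k)

private
  module _ (G : FiniteAbelianGroup c ℓ) where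
    open FiniteAbelianGroup G renaming (sym to ≈-sym; trans to ≈-trans; refl to ≈-refl)
    open GroupProperties group using (ε⁻¹≈ε)

    ×-zero : ∀ n {x} → x ≈ ε → n ×ᴳ x ≈ ε
    ×-zero zero    x≈ε = ≈-refl
    ×-zero (suc n) x≈ε = ≈-trans (∙-cong x≈ε (×-zero n x≈ε)) (identityˡ ε)

    ·-zero : ∀ z {x} → x ≈ ε → z · x ≈ ε
    ·-zero (+ n)    x≈ε = ×-zero n x≈ε
    ·-zero -[1+ n ] x≈ε = ≈-trans (⁻¹-cong (×-zero (suc n) x≈ε)) ε⁻¹≈ε

    sum-zero : ∀ {k} (v : Vector Carrier k) → (∀ i → v i ≈ ε) → sumᴳ v ≈ ε
    sum-zero {zero}  v v≈ε = ≈-refl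
    sum-zero {suc k} v v≈ε =
      ≈-trans (∙-cong (v≈ε zero) (sum-zero (λ i → v (suc i)) (λ i → v≈ε (suc i)))) (identityˡ ε)

    ε∈elements : Any (_≈ ε) elements
    ε∈elements = Any.tabulate⁺ (Inverse.from enumeration ε) (Inverse.inverseˡ enumeration refl)

    zero∈tuples : ∀ k → Any (λ v → ∀ i → v i ≈ ε) (tuples elements k)
    zero∈tuples zero    = here λ ()
    zero∈tuples (suc k) =
      Any.cartesianProductWith⁺ _∷_ (λ x≈ε v≈ε → λ { zero → x≈ε ; (suc i) → v≈ε i })
        ε∈elements (zero∈tuples k)

    ∈⇒length≢0 : ∀ {b} {B : Set b} {x : B} {xs} → x ∈ xs → NonZero (length xs)
    ∈⇒length≢0 (here _)  = _
    ∈⇒length≢0 (there _) = _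

solutions-nonZero : (G : FiniteAbelianGroup c ℓ) (a : Vector ℤ k) → NonZero (length (solutions G a))
solutions-nonZero {k = k} G a =
  let v , v∈ , v≈ε = find (zero∈tuples G k)
  in ∈⇒length≢0 G (∈-filter⁺ (isSolution? G a) v∈ (sum-zero G _ (λ i → ·-zero G (a i) (v≈ε i))))

record Coloring (G : FiniteAbelianGroup c ℓ) (r : ℕ) : Set (c ⊔ˡ ℓ) where
  open FiniteAbelianGroup G using (Carrier; _≈_)
  field
    f       : Fin r → Carrier → ℝ
    f-cong  : ∀ j {s t} → s ≈ t → f j s ≃ f j t
    f≥0     : ∀ j t → 0ℝ ≤ f j t
    f≤1     : ∀ j t → f j t ≤ 1ℝ
    f-total : ∀ t → sum (λ j → f j t) ≃ 1ℝ

μ : (G : FiniteAbelianGroup c ℓ) (a : Vector ℤ k) → Coloring G r → ℝ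
μ G a C =
  fromℚ ((+ 1 / length (solutions G a)) {{solutions-nonZero G a}}) *
  sum (λ s → sum (λ j → product (λ i → f j (List.lookup (solutions G a) s i))))
  where open Coloring C

-- r^{1-k} is written r / rᵏ, which avoids a negative exponent.
threshold : (r k : ℕ) .{{_ : NonZero r}} → ℝ
threshold r k = fromℚ ((+ r / r ^ k) {{ℕ.m^n≢0 r k}})

Uncommon : (G : FiniteAbelianGroup c ℓ) → Vector ℤ k → (r : ℕ) .{{_ : NonZero r}} → Set (c ⊔ˡ ℓ)
Uncommon {k = k} G a r = Σ[ C ∈ Coloring G r ] μ G a C < threshold r k

{-# OPTIONS --safe #-}
module Submission where

-- Color by f_j = α_j + β_j·1_{0} with α_j + β_j/|G| = 1/r, where all but one of
-- the β_j equal some σ > 0 and the remaining one is −(r−1)σ.  Since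
-- multiplication by each a_i is a bijection of G, summing out one coordinate at
-- a time gives, for w = α + β·1_{0} and every k,
--   |G| · Σ_{v ∈ C(E)} Π w(v_i) = (|G|α + β)^k + (|G| − 1) β^k.
-- Hence μ_E − r^{1−k} is a positive multiple of Σ_j β_j^k, which for odd k ≥ 3 is
-- ((r−1) − (r−1)^k) σ^k < 0 because r − 1 ≥ 2.

open import Defs
open import Algebra.Bundles using (CommutativeRing)
import Algebra.Definitions.RawSemiring as RawSemiringDefs
import Algebra.Properties.AbelianGroup as AbelianGroupProperties
import Algebra.Properties.CommutativeMonoid.Mult as MonoidMult
import Algebra.Properties.CommutativeMonoid.Sum as MonoidSum
import Algebra.Properties.CommutativeSemigroup as CommutativeSemigroupProperties
import Algebra.Properties.CommutativeSemiring.Exp as Exp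
import Algebra.Properties.Semiring.Mult as SemiringMult
import Algebra.Properties.Semiring.Sum as SemiringSum
open import Data.Bool.Base using (true; false; if_then_else_)
open import Data.Fin.Base using (Fin; zero; suc)
open import Data.Fin.Permutation using (Permutation′; permutation)
import Data.Fin.Properties as Fin
open import Data.Integer.Base as ℤ using (ℤ; +_; -[1+_]; 0ℤ)
open import Data.Integer.Coprimality using (Coprime)
import Data.Integer.Properties as ℤ
open import Data.List.Base as List using (List; []; _∷_; _++_; length; filter; cartesianProductWith)
open import Data.Nat.Base using (ℕ; zero; suc; NonZero; _≥_; s≤s) renaming (_+_ to _+ℕ_; _*_ to _*ℕ_)
import Data.Nat.Base as ℕ
import Data.Nat.Coprimality as ℕ using (Coprime; coprime-Bézout)
open import Data.Nat.GCD using (module Bézout)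
import Data.Nat.Properties as ℕ
open import Data.Product.Base using (∃-syntax; _,_)
open import Data.Rational.Base as ℚ using (ℚ; 0ℚ; 1ℚ)
import Data.Rational.Properties as ℚ
import Data.Rational.Unnormalised.Base as ℚᵘ
import Data.Rational.Unnormalised.Properties as ℚᵘ
open import Data.Rational.Solver using (module +-*-Solver)
open import Data.Vec.Functional as Vector using (Vector)
open import Function.Base using (_∘_)
open import Function.Bundles using (Inverse; _⇔_; mk⇔; Equivalence)
import Function.Properties.Equivalence as ⇔
open import Level using (Level)
open import Relation.Binary.PropositionalEquality
  using (_≡_; _≢_; refl; sym; trans; cong; cong₂; subst; module ≡-Reasoning)
import Relation.Binary.Reasoning.Setoid as SetoidReasoning
open import Relation.Nullary.Decidable using (Dec; does; does-⇔; dec-true)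
open import Relation.Nullary.Negation using (contradiction)

private
  variable
    c ℓ : Level
    A B : Set c
    k : ℕ

-- Multiplication by an integer coprime to the order of the group.

module _ (G : FiniteAbelianGroup c ℓ) where
  open FiniteAbelianGroup G renaming (refl to ≈-refl; sym to ≈-sym; trans to ≈-trans)
  open AbelianGroupProperties abelianGroup
    using (∙-cancelʳ; inverseʳ-unique; ⁻¹-involutive; ε⁻¹≈ε)
  open MonoidMult commutativeMonoid using (×-congʳ; ×-congˡ; ×-assocˡ)
  open MonoidSum commutativeMonoid
    using (sum-permute; sum-cong-≋; ∑-distrib-+; sum-replicate)
  open Inverse enumeration using (to; from; to-cong; from-cong; strictlyInverseˡ; strictlyInverseʳ)
  open SetoidReasoning setoid

  -- Taken on indices rather than on `Carrier`, because `sum-permute` reindexes sums over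
  -- `Fin order`. Translation by `x ⁻¹` is the inverse.
  translation : Carrier → Permutation′ order
  translation x = permutation (shift x) (shift (x ⁻¹)) (shift-shift (inverseʳ x)) (shift-shift (inverseˡ x))
    where
    shift : Carrier → Fin order → Fin order
    shift y i = from (y ∙ to i)

    shift-shift : ∀ {y z} → y ∙ z ≈ ε → ∀ i → shift y (shift z i) ≡ i
    shift-shift {y} {z} yz≈ε i = trans (from-cong (begin
      y ∙ to (from (z ∙ to i)) ≈⟨ ∙-congˡ (strictlyInverseˡ _) ⟩
      y ∙ (z ∙ to i)           ≈⟨ assoc y z (to i) ⟨
      y ∙ z ∙ to i             ≈⟨ ∙-congʳ yz≈ε ⟩
      ε ∙ to i                 ≈⟨ identityˡ (to i) ⟩
      to i                     ∎)) (strictlyInverseʳ i)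

  -- Translating by x multiplies the product of all elements by xⁿ.
  order×x≈ε : ∀ x → order ×ᴳ x ≈ ε
  order×x≈ε x = ∙-cancelʳ (sumᴳ to) (order ×ᴳ x) ε (begin
    order ×ᴳ x ∙ sumᴳ to                    ≈⟨ ∙-congʳ (sum-replicate order) ⟨
    sumᴳ (λ (_ : Fin order) → x) ∙ sumᴳ to  ≈⟨ ∑-distrib-+ {order} (λ _ → x) to ⟨
    sumᴳ (λ i → x ∙ to i)                   ≈⟨ sum-cong-≋ (λ i → strictlyInverseˡ (x ∙ to i)) ⟨
    sumᴳ (λ i → to (from (x ∙ to i)))       ≈⟨ sum-permute to (translation x) ⟨
    sumᴳ to                                 ≈⟨ identityˡ (sumᴳ to) ⟨
    ε ∙ sumᴳ to                             ∎)

  [m*order]×x≈ε : ∀ m x → (m *ℕ order) ×ᴳ x ≈ ε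
  [m*order]×x≈ε m x = begin
    (m *ℕ order) ×ᴳ x ≈⟨ ×-congˡ (ℕ.*-comm m order) ⟩
    (order *ℕ m) ×ᴳ x ≈⟨ ×-assocˡ x order m ⟨
    order ×ᴳ (m ×ᴳ x) ≈⟨ order×x≈ε (m ×ᴳ x) ⟩
    ε                 ∎

  -- Bézout writes 1 as a combination of `order` and `p`, and the multiple of `order` acts as zero.
  -- Over ℕ the identity comes in two forms, according to which coefficient is negative.
  coprime⇒×-invertible : ∀ {p} → ℕ.Coprime order p → ∃[ q ] (∀ x → (q *ℕ p) ×ᴳ x ≈ x)
  coprime⇒×-invertible {p} coprime with ℕ.coprime-Bézout coprime
  ... | Bézout.-+ m q eq = q , λ x → begin
    (q *ℕ p) ×ᴳ x          ≈⟨ ×-congˡ (sym eq) ⟩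
    x ∙ (m *ℕ order) ×ᴳ x  ≈⟨ ∙-congˡ ([m*order]×x≈ε m x) ⟩
    x ∙ ε                  ≈⟨ identityʳ x ⟩
    x                      ∎
  -- Here q is an inverse of −p, so q p q is an inverse of p.
  ... | Bézout.+- m q eq = q *ℕ p *ℕ q , λ x → begin
    (q *ℕ p *ℕ q *ℕ p) ×ᴳ x    ≈⟨ ×-congˡ (ℕ.*-assoc (q *ℕ p) q p) ⟩
    (q *ℕ p *ℕ (q *ℕ p)) ×ᴳ x  ≈⟨ ×-assocˡ x (q *ℕ p) (q *ℕ p) ⟨
    (q *ℕ p) ×ᴳ (q *ℕ p) ×ᴳ x  ≈⟨ qp×x≈x⁻¹ ((q *ℕ p) ×ᴳ x) ⟩
    ((q *ℕ p) ×ᴳ x) ⁻¹         ≈⟨ ⁻¹-cong (qp×x≈x⁻¹ x) ⟩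
    x ⁻¹ ⁻¹                    ≈⟨ ⁻¹-involutive x ⟩
    x                          ∎
    where
    qp×x≈x⁻¹ : ∀ x → (q *ℕ p) ×ᴳ x ≈ x ⁻¹
    qp×x≈x⁻¹ x = inverseʳ-unique x ((q *ℕ p) ×ᴳ x) (begin
      x ∙ (q *ℕ p) ×ᴳ x  ≈⟨ ×-congˡ eq ⟩
      (m *ℕ order) ×ᴳ x  ≈⟨ [m*order]×x≈ε m x ⟩
      ε                  ∎)

  -- Phrased as an equivalence so that the indicator of an equation in `x` can be traded for the
  -- indicator of a single point.
  ×-solve : ∀ {p} → ℕ.Coprime order p → ∀ b → ∃[ x₀ ] (∀ x → p ×ᴳ x ≈ b ⇔ x ≈ x₀)
  ×-solve {p} coprime b with coprime⇒×-invertible coprime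
  ... | q , qp = q ×ᴳ b , λ x → mk⇔
    (λ px≈b → begin
      x               ≈⟨ qp x ⟨
      (q *ℕ p) ×ᴳ x   ≈⟨ ×-assocˡ x q p ⟨
      q ×ᴳ (p ×ᴳ x)   ≈⟨ ×-congʳ q px≈b ⟩
      q ×ᴳ b          ∎)
    (λ x≈qb → begin
      p ×ᴳ x          ≈⟨ ×-congʳ p x≈qb ⟩
      p ×ᴳ (q ×ᴳ b)   ≈⟨ ×-assocˡ b p q ⟩
      (p *ℕ q) ×ᴳ b   ≈⟨ ×-congˡ (ℕ.*-comm p q) ⟩
      (q *ℕ p) ×ᴳ b   ≈⟨ qp b ⟩
      b               ∎)

  ·-solve : ∀ {z} → Coprime (+ order) z → ∀ b → ∃[ x₀ ] (∀ x → z · x ≈ b ⇔ x ≈ x₀)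
  ·-solve {+ p}      coprime b = ×-solve coprime b
  -- Integer coprimality only sees absolute values, so `coprime` already speaks of `suc p`; the sign
  -- is moved onto `b`.
  ·-solve { -[1+ p ]} coprime b with ×-solve coprime (b ⁻¹)
  ... | x₀ , h = x₀ , λ x → ⇔.trans
    (mk⇔ (λ px⁻¹≈b → ≈-trans (≈-sym (⁻¹-involutive _)) (⁻¹-cong px⁻¹≈b))
         (λ px≈b⁻¹ → ≈-trans (⁻¹-cong px≈b⁻¹) (⁻¹-involutive b)))
    (h x)

  ×-ε : ∀ n → n ×ᴳ ε ≈ ε
  ×-ε zero    = ≈-refl
  ×-ε (suc n) = ≈-trans (identityˡ (n ×ᴳ ε)) (×-ε n)

  ·-ε : ∀ z → z · ε ≈ ε
  ·-ε (+ n)    = ×-ε n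
  ·-ε -[1+ n ] = ≈-trans (⁻¹-cong (×-ε (suc n))) ε⁻¹≈ε

  -- In this form `order` minus one is a visible successor, which later makes the factor |G| - 1 of
  -- the deficit positive.
  nontrivial⇒order : Nontrivial G → ∃[ n ] order ≡ suc (suc n)
  nontrivial⇒order (x , x≉ε) = go order refl
    where
    go : ∀ n → order ≡ n → ∃[ m ] n ≡ suc (suc m)
    go zero eq          = contradiction (subst Fin eq (from ε)) λ ()
    go (suc zero) eq    = contradiction (begin
      x             ≈⟨ strictlyInverseˡ x ⟨
      to (from x)   ≈⟨ to-cong (collapse eq (from x) (from ε)) ⟩
      to (from ε)   ≈⟨ strictlyInverseˡ ε ⟩
      ε             ∎) x≉ε
      where
      collapse : ∀ {n} → n ≡ 1 → (i j : Fin n) → i ≡ j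
      collapse refl zero zero = refl
    go (suc (suc n)) eq = n , refl

-- Indicators and finite sums of rationals.

open CommutativeRing ℚ.+-*-commutativeRing
  using () renaming (semiring to ℚ-semiring; commutativeSemiring to ℚ-commutativeSemiring)
open RawSemiringDefs ℚ.+-*-rawSemiring using () renaming (_×_ to _×ℚ_; _^_ to _^ℚ_; sum to sumℚ; product to productℚ)
open SemiringMult ℚ-semiring using (×-assoc-*; ×1-homo-*)
open Exp ℚ-commutativeSemiring using (^-distrib-*)
open SemiringSum ℚ-semiring using (sum-cong-≗; ∑-distrib-+; sum-replicate; sum-replicate-zero; *-distribˡ-sum; *-distribʳ-sum; ∑-comm)
open +-*-Solver using (solve; _:+_; _:-_; _:*_; :-_; _:=_; con)

-- With repeated addition `ι (suc n)` unfolds to `1ℚ ℚ.+ ι n`, so the ring solver can treat `ι n` as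
-- an atom.
ι : ℕ → ℚ
ι n = n ×ℚ 1ℚ

[_] : Dec A → ℚ
[ d ] = if does d then 1ℚ else 0ℚ

[]-cong : A ⇔ B → (a? : Dec A) (b? : Dec B) → [ a? ] ≡ [ b? ]
[]-cong A⇔B a? b? = cong (if_then 1ℚ else 0ℚ) (does-⇔ A⇔B a? b?)

[]≡1 : (a? : Dec A) → A → [ a? ] ≡ 1ℚ
[]≡1 a? a = cong (if_then 1ℚ else 0ℚ) (dec-true a? a)

sum-const : ∀ n x → sumℚ {n} (λ _ → x) ≡ ι n ℚ.* x
sum-const n x = begin
  sumℚ {n} (λ _ → x) ≡⟨ sum-replicate n ⟩
  n ×ℚ x             ≡⟨ cong (n ×ℚ_) (ℚ.*-identityˡ x) ⟨
  n ×ℚ (1ℚ ℚ.* x)    ≡⟨ ×-assoc-* n 1ℚ x ⟨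
  ι n ℚ.* x          ∎
  where open ≡-Reasoning

sum-select : ∀ {n} (φ : Vector ℚ n) j → sumℚ (λ i → φ i ℚ.* [ i Fin.≟ j ]) ≡ φ j
sum-select {suc n} φ zero = begin
  φ zero ℚ.* 1ℚ ℚ.+ sumℚ (λ i → φ (suc i) ℚ.* 0ℚ)
    ≡⟨ cong₂ ℚ._+_ (ℚ.*-identityʳ (φ zero)) (sum-cong-≗ (λ i → ℚ.*-zeroʳ (φ (suc i)))) ⟩
  φ zero ℚ.+ sumℚ {n} (λ _ → 0ℚ)   ≡⟨ cong (φ zero ℚ.+_) (sum-replicate-zero n) ⟩
  φ zero ℚ.+ 0ℚ                    ≡⟨ ℚ.+-identityʳ (φ zero) ⟩
  φ zero                           ∎
  where open ≡-Reasoning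
sum-select {suc n} φ (suc j) = begin
  φ zero ℚ.* 0ℚ ℚ.+ sumℚ (λ i → φ (suc i) ℚ.* [ i Fin.≟ j ])
    ≡⟨ cong₂ ℚ._+_ (ℚ.*-zeroʳ (φ zero)) (sum-select (φ ∘ suc) j) ⟩
  0ℚ ℚ.+ φ (suc j)                 ≡⟨ ℚ.+-identityˡ (φ (suc j)) ⟩
  φ (suc j)                        ∎
  where open ≡-Reasoning

-- Recursion on the list follows the way `tuples` and `solutions` are built, without passing through
-- positions.
listSum : List A → (A → ℚ) → ℚ
listSum []       g = 0ℚ
listSum (x ∷ xs) g = g x ℚ.+ listSum xs g

listSum-cong : (xs : List A) {g h : A → ℚ} → (∀ x → g x ≡ h x) → listSum xs g ≡ listSum xs h
listSum-cong []       g≡h = refl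
listSum-cong (x ∷ xs) g≡h = cong₂ ℚ._+_ (g≡h x) (listSum-cong xs g≡h)

listSum-*ˡ : ∀ y (xs : List A) g → listSum xs (λ x → y ℚ.* g x) ≡ y ℚ.* listSum xs g
listSum-*ˡ y []       g = sym (ℚ.*-zeroʳ y)
listSum-*ˡ y (x ∷ xs) g =
  trans (cong (y ℚ.* g x ℚ.+_) (listSum-*ˡ y xs g)) (sym (ℚ.*-distribˡ-+ y (g x) (listSum xs g)))

listSum-lookup : (xs : List A) (g : A → ℚ) → sumℚ (λ i → g (List.lookup xs i)) ≡ listSum xs g
listSum-lookup []       g = refl
listSum-lookup (x ∷ xs) g = cong (g x ℚ.+_) (listSum-lookup xs g)

listSum-tabulate : ∀ {n} (h : Fin n → A) (g : A → ℚ) → listSum (List.tabulate h) g ≡ sumℚ (g ∘ h)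
listSum-tabulate {n = zero}  h g = refl
listSum-tabulate {n = suc n} h g = cong (g (h zero) ℚ.+_) (listSum-tabulate (h ∘ suc) g)

listSum-map : (f : A → B) (xs : List A) (g : B → ℚ) → listSum (List.map f xs) g ≡ listSum xs (g ∘ f)
listSum-map f []       g = refl
listSum-map f (x ∷ xs) g = cong (g (f x) ℚ.+_) (listSum-map f xs g)

listSum-++ : (xs ys : List A) (g : A → ℚ) → listSum (xs ++ ys) g ≡ listSum xs g ℚ.+ listSum ys g
listSum-++ []       ys g = sym (ℚ.+-identityˡ _)
listSum-++ (x ∷ xs) ys g = trans (cong (g x ℚ.+_) (listSum-++ xs ys g)) (sym (ℚ.+-assoc (g x) _ _))

listSum-cartesianProductWith : ∀ {d} {D : Set d} (f : A → B → D) xs ys (g : D → ℚ) →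
  listSum (cartesianProductWith f xs ys) g ≡ listSum xs (λ x → listSum ys (λ y → g (f x y)))
listSum-cartesianProductWith f []       ys g = refl
listSum-cartesianProductWith f (x ∷ xs) ys g = trans
  (listSum-++ (List.map (f x) ys) _ g)
  (cong₂ ℚ._+_ (listSum-map (f x) ys g) (listSum-cartesianProductWith f xs ys g))

-- Turning the constraint into a factor lets the sum run over all tuples, where it can be split
-- coordinate by coordinate.
listSum-filter : ∀ {p} {P : A → Set p} (P? : ∀ x → Dec (P x)) xs g →
  listSum (filter P? xs) g ≡ listSum xs (λ x → [ P? x ] ℚ.* g x)
listSum-filter P? []       g = refl
listSum-filter P? (x ∷ xs) g with does (P? x)
... | true  = cong₂ ℚ._+_ (sym (ℚ.*-identityˡ (g x))) (listSum-filter P? xs g)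
... | false = trans (listSum-filter P? xs g)
  (trans (sym (ℚ.+-identityˡ _)) (cong (ℚ._+ listSum xs _) (sym (ℚ.*-zeroˡ (g x)))))

listSum-1 : (xs : List A) → listSum xs (λ _ → 1ℚ) ≡ ι (length xs)
listSum-1 []       = refl
listSum-1 (x ∷ xs) = cong (1ℚ ℚ.+_) (listSum-1 xs)

-- Weighted solution counts for a weight that is constant off the identity.

module TwoValuedWeight (G : FiniteAbelianGroup c ℓ) (α β : ℚ) where
  open FiniteAbelianGroup G renaming (refl to ≈-refl; sym to ≈-sym; trans to ≈-trans)
  open Inverse enumeration using (to; from; to-cong; from-cong; strictlyInverseˡ; strictlyInverseʳ)

  weight : Carrier → ℚ
  weight x = α ℚ.+ β ℚ.* [ x ≟ ε ]

  weight-cong : ∀ {x y} → x ≈ y → weight x ≡ weight y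
  weight-cong {x} {y} x≈y = cong (λ δ → α ℚ.+ β ℚ.* δ)
    ([]-cong (mk⇔ (≈-trans (≈-sym x≈y)) (≈-trans x≈y)) (x ≟ ε) (y ≟ ε))

  sum-select-element : (φ : Carrier → ℚ) → (∀ {x y} → x ≈ y → φ x ≡ φ y) →
    ∀ y → sumℚ (λ i → φ (to i) ℚ.* [ to i ≟ y ]) ≡ φ y
  sum-select-element φ φ-cong y = begin
    sumℚ (λ i → φ (to i) ℚ.* [ to i ≟ y ])
      ≡⟨ sum-cong-≗ (λ i → cong (φ (to i) ℚ.*_) ([]-cong (to≈⇔ i) (to i ≟ y) (i Fin.≟ from y))) ⟩
    sumℚ (λ i → φ (to i) ℚ.* [ i Fin.≟ from y ])
      ≡⟨ sum-select (φ ∘ to) (from y) ⟩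
    φ (to (from y))  ≡⟨ φ-cong (strictlyInverseˡ y) ⟩
    φ y              ∎
    where
    open ≡-Reasoning
    to≈⇔ : ∀ i → to i ≈ y ⇔ i ≡ from y
    to≈⇔ i = mk⇔ (λ eq → trans (sym (strictlyInverseʳ i)) (from-cong eq))
                 (λ eq → ≈-trans (to-cong eq) (strictlyInverseˡ y))

  total : ℚ
  total = ι order ℚ.* α ℚ.+ β

  sum-weight : sumℚ (weight ∘ to) ≡ total
  sum-weight = begin
    sumℚ (weight ∘ to)                                         ≡⟨ ∑-distrib-+ {order} (λ _ → α) _ ⟩
    sumℚ {order} (λ _ → α) ℚ.+ sumℚ (λ i → β ℚ.* [ to i ≟ ε ])
      ≡⟨ cong₂ ℚ._+_ (sum-const order α) (sum-select-element (λ _ → β) (λ _ → refl) ε) ⟩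
    total ∎
    where open ≡-Reasoning

  -- An arbitrary right-hand side `b` is allowed, since summing out a coordinate changes it.
  weightedCount : Vector ℤ k → Carrier → ℚ
  weightedCount {k} a b = listSum (tuples elements k)
    (λ v → [ sumᴳ (λ i → a i · v i) ≟ b ] ℚ.* productℚ (weight ∘ v))

  ∙≈⇔≈⁻¹∙ : ∀ x y z → x ∙ y ≈ z ⇔ y ≈ x ⁻¹ ∙ z
  ∙≈⇔≈⁻¹∙ x y z = mk⇔
    (λ xy≈z → ≈-trans (≈-sym (\\-leftDividesʳ x y)) (∙-congˡ xy≈z))
    (λ y≈x⁻¹z → ≈-trans (∙-congˡ y≈x⁻¹z) (\\-leftDividesˡ x z))
    where open AbelianGroupProperties abelianGroup using (\\-leftDividesˡ; \\-leftDividesʳ)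

  -- Fixing the first coordinate moves its term to the right-hand side and leaves an equation in the
  -- other `k` variables.
  weightedCount-suc : (a : Vector ℤ (suc k)) → ∀ b → weightedCount a b ≡
    sumℚ (λ i → weight (to i) ℚ.* weightedCount (a ∘ suc) ((a zero · to i) ⁻¹ ∙ b))
  weightedCount-suc {k} a b = begin
    weightedCount a b
      ≡⟨ listSum-cartesianProductWith Vector._∷_ elements (tuples elements k) _ ⟩
    listSum elements (λ x → listSum (tuples elements k) (λ v →
      [ ((a zero · x) ∙ S v) ≟ b ] ℚ.* (weight x ℚ.* productℚ (weight ∘ v))))
      ≡⟨ listSum-tabulate to _ ⟩
    sumℚ (λ i → listSum (tuples elements k) (λ v →
      [ ((a zero · to i) ∙ S v) ≟ b ] ℚ.* (weight (to i) ℚ.* productℚ (weight ∘ v))))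
      ≡⟨ sum-cong-≗ (λ i → fibre (to i)) ⟩
    sumℚ (λ i → weight (to i) ℚ.* weightedCount (a ∘ suc) ((a zero · to i) ⁻¹ ∙ b)) ∎
    where
    open ≡-Reasoning
    S : Vector Carrier k → Carrier
    S v = sumᴳ (λ i → a (suc i) · v i)

    fibre : ∀ x → listSum (tuples elements k) (λ v →
        [ ((a zero · x) ∙ S v) ≟ b ] ℚ.* (weight x ℚ.* productℚ (weight ∘ v)))
      ≡ weight x ℚ.* weightedCount (a ∘ suc) ((a zero · x) ⁻¹ ∙ b)
    fibre x = begin
      listSum (tuples elements k) (λ v →
        [ ((a zero · x) ∙ S v) ≟ b ] ℚ.* (weight x ℚ.* productℚ (weight ∘ v)))
        ≡⟨ listSum-cong (tuples elements k) (λ v → trans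
             (cong (ℚ._* (weight x ℚ.* productℚ (weight ∘ v)))
               ([]-cong (∙≈⇔≈⁻¹∙ (a zero · x) (S v) b) (((a zero · x) ∙ S v) ≟ b) (S v ≟ ((a zero · x) ⁻¹ ∙ b))))
             (x∙yz≈y∙xz [ S v ≟ ((a zero · x) ⁻¹ ∙ b) ] (weight x) (productℚ (weight ∘ v)))) ⟩
      listSum (tuples elements k) (λ v →
        weight x ℚ.* ([ S v ≟ ((a zero · x) ⁻¹ ∙ b) ] ℚ.* productℚ (weight ∘ v)))
        ≡⟨ listSum-*ˡ (weight x) (tuples elements k) _ ⟩
      weight x ℚ.* weightedCount (a ∘ suc) ((a zero · x) ⁻¹ ∙ b) ∎
      where open CommutativeSemigroupProperties (CommutativeRing.*-commutativeSemigroup ℚ.+-*-commutativeRing) using (x∙yz≈y∙xz)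

  -- In Fourier terms, `weight` has coefficient `total` at the trivial character and `β` at every
  -- other one; coprimality keeps nontrivial characters nontrivial, and their values at `b` add up
  -- to |G| [b = 0] - 1. The proof avoids characters and goes by induction on `k`.
  order*weightedCount : (a : Vector ℤ k) → (∀ i → Coprime (+ order) (a i)) → ∀ b →
    ι order ℚ.* weightedCount a b ≡ total ^ℚ k ℚ.+ (ι order ℚ.* [ b ≟ ε ] ℚ.- 1ℚ) ℚ.* β ^ℚ k
  order*weightedCount {zero} a coprime b = begin
    ι order ℚ.* ([ ε ≟ b ] ℚ.* 1ℚ ℚ.+ 0ℚ)
      ≡⟨ cong (λ δ → ι order ℚ.* (δ ℚ.* 1ℚ ℚ.+ 0ℚ)) ([]-cong (mk⇔ ≈-sym ≈-sym) (ε ≟ b) (b ≟ ε)) ⟩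
    ι order ℚ.* ([ b ≟ ε ] ℚ.* 1ℚ ℚ.+ 0ℚ)
      ≡⟨ solve 2 (λ n δ → n :* (δ :* con 1ℚ :+ con 0ℚ) := con 1ℚ :+ (n :* δ :- con 1ℚ) :* con 1ℚ) refl (ι order) [ b ≟ ε ] ⟩
    1ℚ ℚ.+ (ι order ℚ.* [ b ≟ ε ] ℚ.- 1ℚ) ℚ.* 1ℚ ∎
    where open ≡-Reasoning
  order*weightedCount {suc k} a coprime b
    -- `x₀` is the only first coordinate that leaves the right-hand side `ε`, so the indicator from
    -- the induction hypothesis picks out one term.
    with x₀ , solution ← ·-solve G {a zero} (coprime zero) b = begin
    n ℚ.* weightedCount a b
      ≡⟨ cong (n ℚ.*_) (weightedCount-suc a b) ⟩
    n ℚ.* sumℚ (λ i → weight (to i) ℚ.* M i)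
      ≡⟨ *-distribˡ-sum n (λ i → weight (to i) ℚ.* M i) ⟩
    sumℚ (λ i → n ℚ.* (weight (to i) ℚ.* M i))
      ≡⟨ sum-cong-≗ term ⟩
    sumℚ (λ i → weight (to i) ℚ.* (P ℚ.- Q) ℚ.+ weight (to i) ℚ.* [ to i ≟ x₀ ] ℚ.* (n ℚ.* Q))
      ≡⟨ ∑-distrib-+ (λ i → weight (to i) ℚ.* (P ℚ.- Q)) _ ⟩
    sumℚ (λ i → weight (to i) ℚ.* (P ℚ.- Q)) ℚ.+
      sumℚ (λ i → weight (to i) ℚ.* [ to i ≟ x₀ ] ℚ.* (n ℚ.* Q))
      ≡⟨ cong₂ ℚ._+_ (*-distribʳ-sum (P ℚ.- Q) (weight ∘ to))
                     (*-distribʳ-sum (n ℚ.* Q) (λ i → weight (to i) ℚ.* [ to i ≟ x₀ ])) ⟨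
    sumℚ (weight ∘ to) ℚ.* (P ℚ.- Q) ℚ.+
      sumℚ (λ i → weight (to i) ℚ.* [ to i ≟ x₀ ]) ℚ.* (n ℚ.* Q)
      ≡⟨ cong₂ (λ s t → s ℚ.* (P ℚ.- Q) ℚ.+ t ℚ.* (n ℚ.* Q))
           sum-weight (sum-select-element weight weight-cong x₀) ⟩
    total ℚ.* (P ℚ.- Q) ℚ.+ (α ℚ.+ β ℚ.* [ x₀ ≟ ε ]) ℚ.* (n ℚ.* Q)
      ≡⟨ cong (λ δ → total ℚ.* (P ℚ.- Q) ℚ.+ (α ℚ.+ β ℚ.* δ) ℚ.* (n ℚ.* Q))
           ([]-cong x₀≈ε⇔b≈ε (x₀ ≟ ε) (b ≟ ε)) ⟩
    total ℚ.* (P ℚ.- Q) ℚ.+ (α ℚ.+ β ℚ.* [ b ≟ ε ]) ℚ.* (n ℚ.* Q)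
      -- Since `total` is `n ℚ.* α ℚ.+ β`, the contribution `n ℚ.* α ℚ.* Q` cancels and only
      -- multiples of `β ℚ.* Q` remain beside the main term.
      ≡⟨ solve 6 (λ n α β δ P Q →
           (n :* α :+ β) :* (P :- Q) :+ (α :+ β :* δ) :* (n :* Q) :=
           (n :* α :+ β) :* P :+ (n :* δ :- con 1ℚ) :* (β :* Q))
           refl n α β [ b ≟ ε ] P Q ⟩
    total ^ℚ suc k ℚ.+ (n ℚ.* [ b ≟ ε ] ℚ.- 1ℚ) ℚ.* β ^ℚ suc k ∎
    where
    open ≡-Reasoning
    n = ι order
    P = total ^ℚ k
    Q = β ^ℚ k
    rest : Fin order → Carrier
    rest i = (a zero · to i) ⁻¹ ∙ b
    M : Fin order → ℚ
    M i = weightedCount (a ∘ suc) (rest i)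

    rest≈ε⇔ : ∀ i → rest i ≈ ε ⇔ to i ≈ x₀
    rest≈ε⇔ i = ⇔.trans (mk⇔
      (λ eq → ≈-trans (≈-sym (identityʳ _)) (Equivalence.from (∙≈⇔≈⁻¹∙ (a zero · to i) ε b) (≈-sym eq)))
      (λ eq → ≈-sym (Equivalence.to (∙≈⇔≈⁻¹∙ (a zero · to i) ε b) (≈-trans (identityʳ _) eq))))
      (solution (to i))

    x₀≈ε⇔b≈ε : x₀ ≈ ε ⇔ b ≈ ε
    -- Multiplication by `a zero` fixes `ε` and is injective.
    x₀≈ε⇔b≈ε = mk⇔
      (λ eq → ≈-trans (≈-sym (Equivalence.from (solution ε) (≈-sym eq))) (·-ε G (a zero)))
      (λ eq → ≈-sym (Equivalence.to (solution ε) (≈-trans (·-ε G (a zero)) (≈-sym eq))))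

    term : ∀ i → n ℚ.* (weight (to i) ℚ.* M i) ≡
      weight (to i) ℚ.* (P ℚ.- Q) ℚ.+ weight (to i) ℚ.* [ to i ≟ x₀ ] ℚ.* (n ℚ.* Q)
    term i = begin
      n ℚ.* (weight (to i) ℚ.* M i)
        ≡⟨ solve 3 (λ n w m → n :* (w :* m) := w :* (n :* m)) refl n (weight (to i)) (M i) ⟩
      weight (to i) ℚ.* (n ℚ.* M i)
        ≡⟨ cong (weight (to i) ℚ.*_) (order*weightedCount (a ∘ suc) (coprime ∘ suc) (rest i)) ⟩
      weight (to i) ℚ.* (P ℚ.+ (n ℚ.* [ rest i ≟ ε ] ℚ.- 1ℚ) ℚ.* Q)
        ≡⟨ cong (λ δ → weight (to i) ℚ.* (P ℚ.+ (n ℚ.* δ ℚ.- 1ℚ) ℚ.* Q))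
             ([]-cong (rest≈ε⇔ i) (rest i ≟ ε) (to i ≟ x₀)) ⟩
      weight (to i) ℚ.* (P ℚ.+ (n ℚ.* [ to i ≟ x₀ ] ℚ.- 1ℚ) ℚ.* Q)
        ≡⟨ solve 5 (λ n w δ P Q →
             w :* (P :+ (n :* δ :- con 1ℚ) :* Q) := w :* (P :- Q) :+ w :* δ :* (n :* Q))
             refl n (weight (to i)) [ to i ≟ x₀ ] P Q ⟩
      weight (to i) ℚ.* (P ℚ.- Q) ℚ.+ weight (to i) ℚ.* [ to i ≟ x₀ ] ℚ.* (n ℚ.* Q) ∎

  order*sum-solutions : (a : Vector ℤ k) → (∀ i → Coprime (+ order) (a i)) →
    ι order ℚ.* listSum (solutions G a) (λ v → productℚ (weight ∘ v)) ≡
    total ^ℚ k ℚ.+ (ι order ℚ.- 1ℚ) ℚ.* β ^ℚ k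
  order*sum-solutions {k} a coprime = begin
    n ℚ.* listSum (solutions G a) (λ v → productℚ (weight ∘ v))
      ≡⟨ cong (n ℚ.*_) (listSum-filter (isSolution? G a) (tuples elements k) (λ v → productℚ (weight ∘ v))) ⟩
    n ℚ.* weightedCount a ε
      ≡⟨ order*weightedCount a coprime ε ⟩
    total ^ℚ k ℚ.+ (n ℚ.* [ ε ≟ ε ] ℚ.- 1ℚ) ℚ.* β ^ℚ k
      ≡⟨ cong (λ d → total ^ℚ k ℚ.+ (d ℚ.- 1ℚ) ℚ.* β ^ℚ k)
           (trans (cong (n ℚ.*_) ([]≡1 (ε ≟ ε) ≈-refl)) (ℚ.*-identityʳ n)) ⟩
    total ^ℚ k ℚ.+ (n ℚ.- 1ℚ) ℚ.* β ^ℚ k ∎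
    where
    open ≡-Reasoning
    n = ι order

-- Fractions, powers and inequalities in ℚ.

p/d*ιd≡ιp : ∀ p d .{{_ : NonZero d}} → (+ p ℚ./ d) ℚ.* ι d ≡ ι p
-- The quotient `ℚ./` reduces to lowest terms and is stuck on variables; unnormalised fractions
-- avoid the gcd.
p/d*ιd≡ιp p d@(suc d-1) = ℚ.toℚᵘ-injective (begin
  ℚ.toℚᵘ ((+ p ℚ./ d) ℚ.* ι d)               ≈⟨ ℚ.toℚᵘ-homo-* (+ p ℚ./ d) (ι d) ⟩
  ℚ.toℚᵘ (+ p ℚ./ d) ℚᵘ.* ℚ.toℚᵘ (ι d)       ≈⟨ ℚᵘ.*-cong (ℚ.toℚᵘ-fromℚᵘ (ℚᵘ.mkℚᵘ (+ p) d-1)) (toℚᵘ-ι d) ⟩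
  ℚᵘ.mkℚᵘ (+ p) d-1 ℚᵘ.* ℚᵘ.mkℚᵘ (+ d) 0     ≈⟨ ℚᵘ.*≡* (cancel (+ p) (+ d)) ⟩
  ℚᵘ.mkℚᵘ (+ p) 0                            ≈⟨ toℚᵘ-ι p ⟨
  ℚ.toℚᵘ (ι p)                               ∎)
  where
  open SetoidReasoning ℚᵘ.≃-setoid
  cancel : ∀ x y → x ℤ.* y ℤ.* + 1 ≡ x ℤ.* (y ℤ.* + 1)
  cancel x y = ℤ.*-assoc x y (+ 1)

  toℚᵘ-ι : ∀ n → ℚ.toℚᵘ (ι n) ℚᵘ.≃ ℚᵘ.mkℚᵘ (+ n) 0
  toℚᵘ-ι zero    = ℚᵘ.≃-refl
  toℚᵘ-ι (suc n) = begin
    ℚ.toℚᵘ (1ℚ ℚ.+ ι n)                    ≈⟨ ℚ.toℚᵘ-homo-+ 1ℚ (ι n) ⟩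
    ℚᵘ.1ℚᵘ ℚᵘ.+ ℚ.toℚᵘ (ι n)               ≈⟨ ℚᵘ.+-congʳ ℚᵘ.1ℚᵘ (toℚᵘ-ι n) ⟩
    ℚᵘ.1ℚᵘ ℚᵘ.+ ℚᵘ.mkℚᵘ (+ n) 0            ≈⟨ ℚᵘ.*≡* (cong (λ z → (+ 1 ℤ.+ z) ℤ.* + 1) (ℤ.*-identityʳ (+ n))) ⟩
    ℚᵘ.mkℚᵘ (+ suc n) 0                    ∎

ι≥0 : ∀ n → 0ℚ ℚ.≤ ι n
ι≥0 zero    = ℚ.≤-refl
ι≥0 (suc n) = ℚ.+-mono-≤ (ℚ.nonNegative⁻¹ 1ℚ) (ι≥0 n)

ι>0 : ∀ n → 0ℚ ℚ.< ι (suc n)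
ι>0 n = ℚ.+-mono-<-≤ (ℚ.positive⁻¹ 1ℚ) (ι≥0 n)

1/ι>0 : ∀ n .{{_ : NonZero n}} → 0ℚ ℚ.< + 1 ℚ./ n
1/ι>0 n = ℚ.positive⁻¹ (+ 1 ℚ./ n) {{ℚ.normalize-pos 1 n}}

ι-^ : ∀ m k → ι (m ℕ.^ k) ≡ ι m ^ℚ k
ι-^ m zero    = refl
ι-^ m (suc k) = trans (×1-homo-* m (m ℕ.^ k)) (cong (ι m ℚ.*_) (ι-^ m k))

*-≥0 : ∀ {p q} → 0ℚ ℚ.≤ p → 0ℚ ℚ.≤ q → 0ℚ ℚ.≤ p ℚ.* q
*-≥0 {p} {q} 0≤p 0≤q = ℚ.nonNegative⁻¹ (p ℚ.* q)
  {{ℚ.nonNeg*nonNeg⇒nonNeg p {{ℚ.nonNegative 0≤p}} q {{ℚ.nonNegative 0≤q}}}}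

*->0 : ∀ {p q} → 0ℚ ℚ.< p → 0ℚ ℚ.< q → 0ℚ ℚ.< p ℚ.* q
*->0 {p} {q} 0<p 0<q = ℚ.positive⁻¹ (p ℚ.* q)
  {{ℚ.pos*pos⇒pos p {{ℚ.positive 0<p}} q {{ℚ.positive 0<q}}}}

^->0 : ∀ {p} → 0ℚ ℚ.< p → ∀ k → 0ℚ ℚ.< p ^ℚ k
^->0 0<p zero    = ℚ.positive⁻¹ 1ℚ
^->0 0<p (suc k) = *->0 0<p (^->0 0<p k)

p<q⇒0<q-p : ∀ {p q} → p ℚ.< q → 0ℚ ℚ.< q ℚ.- p
p<q⇒0<q-p {p} {q} p<q = subst (ℚ._< q ℚ.- p) (ℚ.+-inverseʳ p) (ℚ.+-monoˡ-< (ℚ.- p) p<q)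

p<p*q : ∀ {p q} → 0ℚ ℚ.< p → 1ℚ ℚ.< q → p ℚ.< p ℚ.* q
p<p*q {p} {q} 0<p 1<q = subst (ℚ._< p ℚ.* q) (ℚ.*-identityʳ p) (ℚ.*-monoʳ-<-pos p {{ℚ.positive 0<p}} 1<q)

p<p^k : ∀ {p} → 1ℚ ℚ.< p → ∀ {k} → k ≥ 2 → p ℚ.< p ^ℚ k
p<p^k 1<p {suc zero} (s≤s ())
p<p^k {p} 1<p {suc (suc k)} _ = p<p*q 0<p (1<p^[1+k] k)
  where
  0<p = ℚ.<-trans (ℚ.positive⁻¹ 1ℚ) 1<p
  1<p^[1+k] : ∀ k → 1ℚ ℚ.< p ^ℚ suc k
  1<p^[1+k] zero    = subst (1ℚ ℚ.<_) (sym (ℚ.*-identityʳ p)) 1<p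
  1<p^[1+k] (suc k) = ℚ.<-trans 1<p (p<p*q 0<p (1<p^[1+k] k))

-- This is where the parity of the number of variables enters.
neg-^-odd : ∀ p m → (ℚ.- p) ^ℚ (2 *ℕ m +ℕ 1) ≡ ℚ.- (p ^ℚ (2 *ℕ m +ℕ 1))
neg-^-odd p zero    = solve 1 (λ p → :- p :* con 1ℚ := :- (p :* con 1ℚ)) refl p
-- The rewrite exposes the second successor in the exponent, so that two sign changes come off
-- together and cancel.
neg-^-odd p (suc m) rewrite ℕ.+-suc m (m +ℕ 0) = trans
  (cong (λ x → ℚ.- p ℚ.* (ℚ.- p ℚ.* x)) (neg-^-odd p m))
  (solve 2 (λ p x → :- p :* (:- p :* :- x) := :- (p :* (p :* x))) refl p (p ^ℚ (2 *ℕ m +ℕ 1)))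

0≤[] : (a? : Dec A) → 0ℚ ℚ.≤ [ a? ]
0≤[] a? with does a?
... | true  = ℚ.nonNegative⁻¹ 1ℚ
... | false = ℚ.≤-refl

0≤1-[] : (a? : Dec A) → 0ℚ ℚ.≤ 1ℚ ℚ.- [ a? ]
0≤1-[] a? with does a?
... | true  = ℚ.≤-refl
... | false = ℚ.nonNegative⁻¹ 1ℚ

sumℚ≥0 : ∀ {n} (xs : Vector ℚ n) → (∀ i → 0ℚ ℚ.≤ xs i) → 0ℚ ℚ.≤ sumℚ xs
sumℚ≥0 {zero}  xs xs≥0 = ℚ.≤-refl
sumℚ≥0 {suc n} xs xs≥0 = ℚ.+-mono-≤ (xs≥0 zero) (sumℚ≥0 (xs ∘ suc) (xs≥0 ∘ suc))

xᵢ≤sumℚ : ∀ {n} (xs : Vector ℚ n) → (∀ i → 0ℚ ℚ.≤ xs i) → ∀ i → xs i ℚ.≤ sumℚ xs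
xᵢ≤sumℚ {suc n} xs xs≥0 zero    = subst (ℚ._≤ sumℚ xs) (ℚ.+-identityʳ (xs zero))
  (ℚ.+-monoʳ-≤ (xs zero) (sumℚ≥0 (xs ∘ suc) (xs≥0 ∘ suc)))
xᵢ≤sumℚ {suc n} xs xs≥0 (suc i) = subst (ℚ._≤ sumℚ xs) (ℚ.+-identityˡ (xs (suc i)))
  (ℚ.+-mono-≤ (xs≥0 zero) (xᵢ≤sumℚ (xs ∘ suc) (xs≥0 ∘ suc) i))

-- From rational to real colorings.

seq-sum : ∀ {k} (xs : Vector ℝ k) n → seq (sum xs) n ≡ sumℚ (λ i → seq (xs i) n)
seq-sum {zero}  xs n = refl
seq-sum {suc k} xs n = cong (seq (xs zero) n ℚ.+_) (seq-sum (xs ∘ suc) n)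

seq-product : ∀ {k} (xs : Vector ℝ k) n → seq (product xs) n ≡ productℚ (λ i → seq (xs i) n)
seq-product {zero}  xs n = refl
seq-product {suc k} xs n = cong (seq (xs zero) n ℚ.*_) (seq-product (xs ∘ suc) n)

fromℚ-≤ : ∀ {p q} → p ℚ.≤ q → fromℚ p ≤ fromℚ q
fromℚ-≤ {p} {q} p≤q ε 0<ε = 0 , λ _ _ →
  subst (ℚ._≤ q ℚ.+ ε) (ℚ.+-identityʳ p) (ℚ.+-mono-≤ p≤q (ℚ.<⇒≤ 0<ε))

seq-≡⇒≃ : ∀ {x y} → (∀ n → seq x n ≡ seq y n) → x ≃ y
seq-≡⇒≃ {x} {y} x≡y ε 0<ε = 0 , λ n _ →
  subst (λ d → ℚ.∣ d ∣ ℚ.≤ ε) (sym (trans (cong (ℚ._- seq y n) (x≡y n)) (ℚ.+-inverseʳ (seq y n)))) (ℚ.<⇒≤ 0<ε)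

-- The rational gap demanded by `_<_` is `q ℚ.- p`, valid from index 0 on.
constant-< : ∀ {x q p} → (∀ n → seq x n ≡ p) → p ℚ.< q → x < fromℚ q
constant-< {x} {q} {p} x≡p p<q = q ℚ.- p , p<q⇒0<q-p p<q , 0 , λ n _ → ℚ.≤-reflexive (trans
  (cong (ℚ._+ (q ℚ.- p)) (x≡p n)) (solve 2 (λ p q → p :+ (q :- p) := q) refl p q))

module RationalColoring (G : FiniteAbelianGroup c ℓ) {r : ℕ}
  (w : Fin r → FiniteAbelianGroup.Carrier G → ℚ)
  (w-cong : ∀ j {s t} → FiniteAbelianGroup._≈_ G s t → w j s ≡ w j t)
  (w≥0 : ∀ j t → 0ℚ ℚ.≤ w j t)
  (w-total : ∀ t → sumℚ (λ j → w j t) ≡ 1ℚ) where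

  coloring : Coloring G r
  coloring = record
    { f       = λ j t → fromℚ (w j t)
    ; f-cong  = λ j {s} {t} s≈t → seq-≡⇒≃ {fromℚ (w j s)} {fromℚ (w j t)} λ _ → w-cong j s≈t
    ; f≥0     = λ j t → fromℚ-≤ (w≥0 j t)
    ; f≤1     = λ j t → fromℚ-≤ (subst (w j t ℚ.≤_) (w-total t) (xᵢ≤sumℚ (λ i → w i t) (λ i → w≥0 i t) j))
    ; f-total = λ t → seq-≡⇒≃ {sum (λ j → fromℚ (w j t))} {1ℝ} λ n →
        trans (seq-sum (λ j → fromℚ (w j t)) n) (w-total t)
    }

  -- The color sum is brought outside, so that each color class can be counted separately by the
  -- two-valued formula.
  seq-μ : (a : Vector ℤ k) → ∀ n → seq (μ G a coloring) n ≡
    (+ 1 ℚ./ length (solutions G a)) {{solutions-nonZero G a}} ℚ.*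
    sumℚ (λ j → listSum (solutions G a) (λ v → productℚ (w j ∘ v)))
  seq-μ a n = cong ((+ 1 ℚ./ length sols) {{solutions-nonZero G a}} ℚ.*_) (begin
    seq (sum (λ s → sum (λ j → monochromatic s j))) n
      ≡⟨ seq-sum (λ s → sum (λ j → monochromatic s j)) n ⟩
    sumℚ (λ s → seq (sum (λ j → monochromatic s j)) n)
      ≡⟨ sum-cong-≗ {length sols} (λ s → trans
           (seq-sum (λ j → monochromatic s j) n)
           (sum-cong-≗ {r} (λ j → seq-product (λ i → fromℚ (w j (List.lookup sols s i))) n))) ⟩
    sumℚ (λ s → sumℚ (λ j → productℚ (λ i → w j (List.lookup sols s i))))
      ≡⟨ ∑-comm {length sols} {r} _ ⟩
    sumℚ (λ j → sumℚ (λ s → productℚ (λ i → w j (List.lookup sols s i))))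
      ≡⟨ sum-cong-≗ {r} (λ j → listSum-lookup sols (λ v → productℚ (w j ∘ v))) ⟩
    sumℚ (λ j → listSum sols (λ v → productℚ (w j ∘ v))) ∎)
    where
    open ≡-Reasoning
    sols = solutions G a
    monochromatic : Fin (length sols) → Fin r → ℝ
    monochromatic s j = product (λ i → fromℚ (w j (List.lookup sols s i)))

-- The coloring biased at the identity, and its deficit.

module BiasedColoring (G : FiniteAbelianGroup c ℓ) (t n : ℕ)
  (order≡2+n : FiniteAbelianGroup.order G ≡ suc (suc n)) where
  open FiniteAbelianGroup G using (Carrier; _≟_; ε; order)

  r ρ : ℕ
  r = suc (suc (suc t))
  ρ = suc (suc t)

  -- These are 1/r, 1/(r(r - 1)) and 1/|G|. The size of `σ` makes the negative bias exactly `q`, so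
  -- color `zero` still has the nonnegative weight `q ℚ.* v` at `ε`.
  q σ v : ℚ
  q = + 1 ℚ./ r
  σ = q ℚ.* (+ 1 ℚ./ ρ)
  v = + 1 ℚ./ suc (suc n)

  q*r≡1 : q ℚ.* ι r ≡ 1ℚ
  q*r≡1 = p/d*ιd≡ιp 1 r

  v*order≡1 : v ℚ.* ι (suc (suc n)) ≡ 1ℚ
  v*order≡1 = p/d*ιd≡ιp 1 (suc (suc n))

  σ*ρ≡q : σ ℚ.* ι ρ ≡ q
  σ*ρ≡q = trans (ℚ.*-assoc q (+ 1 ℚ./ ρ) (ι ρ))
    (trans (cong (q ℚ.*_) (p/d*ιd≡ιp 1 ρ)) (ℚ.*-identityʳ q))

  0<q : 0ℚ ℚ.< q
  0<q = 1/ι>0 r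

  0<σ : 0ℚ ℚ.< σ
  0<σ = *->0 0<q (1/ι>0 ρ)

  0<v : 0ℚ ℚ.< v
  0<v = 1/ι>0 (suc (suc n))

  -- α j is q − β j / |G|, written without subtraction so that positivity is visible.
  α β : Fin r → ℚ
  α zero    = q ℚ.* (1ℚ ℚ.+ v)
  α (suc _) = σ ℚ.* (ι (suc t) ℚ.+ v ℚ.* ι (suc n))
  β zero    = ℚ.- q
  β (suc _) = σ

  module W (j : Fin r) = TwoValuedWeight G (α j) (β j)

  weight≥0 : ∀ j x → 0ℚ ℚ.≤ W.weight j x
  weight≥0 zero x = subst (0ℚ ℚ.≤_)
    (solve 3 (λ q v δ → q :* ((con 1ℚ :- δ) :+ v) := q :* (con 1ℚ :+ v) :+ (:- q) :* δ) refl q v [ x ≟ ε ])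
    (*-≥0 (ℚ.<⇒≤ 0<q) (ℚ.+-mono-≤ (0≤1-[] (x ≟ ε)) (ℚ.<⇒≤ 0<v)))
  weight≥0 (suc j) x = ℚ.+-mono-≤
    (*-≥0 (ℚ.<⇒≤ 0<σ) (ℚ.+-mono-≤ (ι≥0 (suc t)) (*-≥0 (ℚ.<⇒≤ 0<v) (ι≥0 (suc n)))))
    (*-≥0 (ℚ.<⇒≤ 0<σ) (0≤[] (x ≟ ε)))

  -- The biases at `ε` cancel because `σ ℚ.* ι ρ` is `q`. The constants add up to `q` times 1 + (r -
  -- 2) + 1.
  weight-total : ∀ x → sumℚ (λ j → W.weight j x) ≡ 1ℚ
  weight-total x = begin
    W.weight zero x ℚ.+ sumℚ {ρ} (λ _ → σ ℚ.* (T ℚ.+ v ℚ.* N) ℚ.+ σ ℚ.* δ)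
      ≡⟨ cong (W.weight zero x ℚ.+_) (sum-const ρ _) ⟩
    (q ℚ.* (1ℚ ℚ.+ v) ℚ.+ (ℚ.- q) ℚ.* δ) ℚ.+ ι ρ ℚ.* (σ ℚ.* (T ℚ.+ v ℚ.* N) ℚ.+ σ ℚ.* δ)
      ≡⟨ solve 7 (λ q v δ R σ T N →
           (q :* (con 1ℚ :+ v) :+ (:- q) :* δ) :+ R :* (σ :* (T :+ v :* N) :+ σ :* δ) :=
           q :* (con 1ℚ :+ v :- δ) :+ (σ :* R) :* (T :+ v :* N :+ δ))
           refl q v δ (ι ρ) σ T N ⟩
    q ℚ.* (1ℚ ℚ.+ v ℚ.- δ) ℚ.+ (σ ℚ.* ι ρ) ℚ.* (T ℚ.+ v ℚ.* N ℚ.+ δ)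
      ≡⟨ cong (λ p → q ℚ.* (1ℚ ℚ.+ v ℚ.- δ) ℚ.+ p ℚ.* (T ℚ.+ v ℚ.* N ℚ.+ δ)) σ*ρ≡q ⟩
    q ℚ.* (1ℚ ℚ.+ v ℚ.- δ) ℚ.+ q ℚ.* (T ℚ.+ v ℚ.* N ℚ.+ δ)
      ≡⟨ solve 5 (λ q v δ T N →
           q :* (con 1ℚ :+ v :- δ) :+ q :* (T :+ v :* N :+ δ) :=
           q :* (con 1ℚ :+ T :+ v :* (con 1ℚ :+ N)))
           refl q v δ T N ⟩
    q ℚ.* (1ℚ ℚ.+ T ℚ.+ v ℚ.* (1ℚ ℚ.+ N))
      ≡⟨ cong (λ y → q ℚ.* (1ℚ ℚ.+ T ℚ.+ y)) v*order≡1 ⟩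
    q ℚ.* (1ℚ ℚ.+ T ℚ.+ 1ℚ)
      ≡⟨ cong (q ℚ.*_) (ℚ.+-comm (1ℚ ℚ.+ T) 1ℚ) ⟩
    q ℚ.* ι r
      ≡⟨ q*r≡1 ⟩
    1ℚ ∎
    where
    open ≡-Reasoning
    δ = [ x ≟ ε ]
    T = ι (suc t)
    N = ι (suc n)

  open RationalColoring G W.weight (λ j → W.weight-cong j) weight≥0 weight-total public
    using (coloring; seq-μ)

  -- Every color has average 1/r, so the main term of the count is that of the uniform coloring.
  total≡order*q : ∀ j → W.total j ≡ ι order ℚ.* q
  total≡order*q j = trans (cong (λ o → ι o ℚ.* α j ℚ.+ β j) order≡2+n)
    (trans (go j) (cong (λ o → ι o ℚ.* q) (sym order≡2+n)))
    where
    open ≡-Reasoning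
    N = ι (suc n)
    T = ι (suc t)
    O = ι (suc (suc n))
    go : ∀ j → O ℚ.* α j ℚ.+ β j ≡ O ℚ.* q
    go zero = begin
      O ℚ.* (q ℚ.* (1ℚ ℚ.+ v)) ℚ.+ ℚ.- q
        ≡⟨ solve 3 (λ O q v → O :* (q :* (con 1ℚ :+ v)) :+ :- q := O :* q :+ q :* (v :* O :- con 1ℚ)) refl O q v ⟩
      O ℚ.* q ℚ.+ q ℚ.* (v ℚ.* O ℚ.- 1ℚ)
        ≡⟨ cong (λ y → O ℚ.* q ℚ.+ q ℚ.* (y ℚ.- 1ℚ)) v*order≡1 ⟩
      O ℚ.* q ℚ.+ q ℚ.* 0ℚ
        ≡⟨ solve 2 (λ O q → O :* q :+ q :* con 0ℚ := O :* q) refl O q ⟩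
      O ℚ.* q ∎
    go (suc j) = begin
      O ℚ.* (σ ℚ.* (T ℚ.+ v ℚ.* N)) ℚ.+ σ
        ≡⟨ solve 5 (λ O σ T v N → O :* (σ :* (T :+ v :* N)) :+ σ := σ :* (O :* T :+ (v :* O) :* N :+ con 1ℚ)) refl O σ T v N ⟩
      σ ℚ.* (O ℚ.* T ℚ.+ (v ℚ.* O) ℚ.* N ℚ.+ 1ℚ)
        ≡⟨ cong (λ y → σ ℚ.* (O ℚ.* T ℚ.+ y ℚ.* N ℚ.+ 1ℚ)) v*order≡1 ⟩
      σ ℚ.* (O ℚ.* T ℚ.+ 1ℚ ℚ.* N ℚ.+ 1ℚ)
        ≡⟨ solve 3 (λ σ T N →
             σ :* ((con 1ℚ :+ N) :* T :+ con 1ℚ :* N :+ con 1ℚ) := (con 1ℚ :+ N) :* (σ :* (con 1ℚ :+ T)))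
             refl σ T N ⟩
      O ℚ.* (σ ℚ.* ι ρ)
        ≡⟨ cong (O ℚ.*_) σ*ρ≡q ⟩
      O ℚ.* q ∎

  module _ (m : ℕ) (m≥1 : m ≥ 1) (a : Vector ℤ (2 *ℕ m +ℕ 1))
    (coprime : ∀ i → Coprime (+ order) (a i)) where

    κ : ℕ
    κ = 2 *ℕ m +ℕ 1

    κ≥2 : κ ≥ 2
    κ≥2 = ℕ.≤-trans (ℕ.*-monoʳ-≤ 2 m≥1) (ℕ.m≤m+n (2 *ℕ m) 1)

    colorSum : Fin r → ℚ
    colorSum j = listSum (solutions G a) (λ v → productℚ (W.weight j ∘ v))

    -- This is -(|G| - 1) times the sum of the κ-th powers of the `β j`, with `q` written as
    -- `σ ℚ.* ι ρ`.
    deficit : ℚ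
    deficit = ι (suc n) ℚ.* (σ ^ℚ κ ℚ.* (ι ρ ^ℚ κ ℚ.- ι ρ))

    -- The first factor needs |G| ≥ 2; the last needs `ρ` ≥ 2, that is r ≥ 3, together with `κ` ≥ 2.
    0<deficit : 0ℚ ℚ.< deficit
    0<deficit = *->0 (ι>0 n) (*->0 (^->0 0<σ κ) (p<q⇒0<q-p (p<p^k 1<ρ κ≥2)))
      where
      1<ρ : 1ℚ ℚ.< ι ρ
      1<ρ = subst (ℚ._< ι ρ) (ℚ.+-identityʳ 1ℚ) (ℚ.+-monoʳ-< 1ℚ (ι>0 t))

    order*colorSum : ∀ j → ι order ℚ.* colorSum j ≡
      (ι order ℚ.* q) ^ℚ κ ℚ.+ ι (suc n) ℚ.* β j ^ℚ κ
    order*colorSum j = trans (W.order*sum-solutions j a coprime)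
      (cong₂ (λ s d → s ^ℚ κ ℚ.+ d ℚ.* β j ^ℚ κ) (total≡order*q j)
        (trans (cong (λ o → ι o ℚ.- 1ℚ) order≡2+n)
               (solve 1 (λ N → con 1ℚ :+ N :- con 1ℚ := N) refl (ι (suc n)))))

    order*sum-colorSum : ι order ℚ.* sumℚ colorSum ≡ ι r ℚ.* (ι order ℚ.* q) ^ℚ κ ℚ.- deficit
    order*sum-colorSum = begin
      ι order ℚ.* sumℚ colorSum
        ≡⟨ *-distribˡ-sum (ι order) colorSum ⟩
      sumℚ (λ j → ι order ℚ.* colorSum j)
        ≡⟨ sum-cong-≗ order*colorSum ⟩
      -- Color `zero` is split off; the other `ρ` colors contribute equally.
      (P ℚ.+ N ℚ.* (ℚ.- q) ^ℚ κ) ℚ.+ sumℚ {ρ} (λ _ → P ℚ.+ N ℚ.* Σ)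
        ≡⟨ cong₂ (λ x y → (P ℚ.+ N ℚ.* x) ℚ.+ y) [-q]^κ (sum-const ρ _) ⟩
      (P ℚ.+ N ℚ.* (ℚ.- (Σ ℚ.* R))) ℚ.+ ι ρ ℚ.* (P ℚ.+ N ℚ.* Σ)
        ≡⟨ solve 5 (λ P N Σ R ρ →
             (P :+ N :* (:- (Σ :* R))) :+ ρ :* (P :+ N :* Σ) :=
             (con 1ℚ :+ ρ) :* P :- N :* (Σ :* (R :- ρ)))
             refl P N Σ R (ι ρ) ⟩
      ι r ℚ.* P ℚ.- deficit ∎
      where
      open ≡-Reasoning
      P = (ι order ℚ.* q) ^ℚ κ
      N = ι (suc n)
      Σ = σ ^ℚ κ
      R = ι ρ ^ℚ κ
      [-q]^κ : (ℚ.- q) ^ℚ κ ≡ ℚ.- (Σ ℚ.* R)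
      [-q]^κ = trans (neg-^-odd q m) (cong ℚ.-_
        (trans (cong (_^ℚ κ) (sym σ*ρ≡q)) (^-distrib-* σ (ι ρ) κ)))

    -- Counting solutions is the case of the constant weight 1.
    order*solutions : ι order ℚ.* ι (length (solutions G a)) ≡ ι order ^ℚ κ
    order*solutions = begin
      ι order ℚ.* ι (length (solutions G a))
        ≡⟨ cong (ι order ℚ.*_) (trans (sym (listSum-1 (solutions G a)))
             (listSum-cong (solutions G a) (λ v → sym (product-weight v)))) ⟩
      ι order ℚ.* listSum (solutions G a) (λ v → productℚ (weight ∘ v))
        ≡⟨ order*sum-solutions a coprime ⟩
      total ^ℚ κ ℚ.+ (ι order ℚ.- 1ℚ) ℚ.* 0ℚ ^ℚ κ
        ≡⟨ cong₂ (λ s z → s ^ℚ κ ℚ.+ (ι order ℚ.- 1ℚ) ℚ.* z)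
             (solve 1 (λ o → o :* con 1ℚ :+ con 0ℚ := o) refl (ι order)) (0^ κ≥2) ⟩
      ι order ^ℚ κ ℚ.+ (ι order ℚ.- 1ℚ) ℚ.* 0ℚ
        ≡⟨ solve 2 (λ x y → x :+ y :* con 0ℚ := x) refl (ι order ^ℚ κ) (ι order ℚ.- 1ℚ) ⟩
      ι order ^ℚ κ ∎
      where
      open ≡-Reasoning
      open TwoValuedWeight G 1ℚ 0ℚ
      0^ : ∀ {k} → k ≥ 2 → 0ℚ ^ℚ k ≡ 0ℚ
      0^ {suc k} _ = ℚ.*-zeroˡ (0ℚ ^ℚ k)
      product-weight : ∀ {k} (v : Vector Carrier k) → productℚ (weight ∘ v) ≡ 1ℚ
      product-weight {zero}  v = refl
      product-weight {suc k} v = cong₂ ℚ._*_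
        (trans (cong (1ℚ ℚ.+_) (ℚ.*-zeroˡ [ v zero ≟ ε ])) (ℚ.+-identityʳ 1ℚ))
        (product-weight (v ∘ suc))

    -- After multiplication by `ι order` the claim becomes `u ℚ.* (X ℚ.- deficit) ℚ.< u ℚ.* X`.
    -- Cancelling that factor from a strict inequality only takes its nonnegativity.
    uncommon : .{{_ : NonZero r}} → Uncommon G a r
    uncommon = coloring , constant-< {μ G a coloring} (seq-μ a)
      (ℚ.*-cancelˡ-<-nonNeg (ι order) {{ℚ.nonNegative (ι≥0 order)}}
        (subst (λ z → ι order ℚ.* (u ℚ.* sumℚ colorSum) ℚ.< z) (sym order*threshold)
          (subst (ℚ._< u ℚ.* X) (sym order*μ) (ℚ.*-monoʳ-<-pos u {{ℚ.positive 0<u}} X-deficit<X))))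
      where
      open ≡-Reasoning
      L = length (solutions G a)
      instance
        L≢0 : NonZero L
        L≢0 = solutions-nonZero G a
        r^κ≢0 : NonZero (r ℕ.^ κ)
        r^κ≢0 = ℕ.m^n≢0 r κ
      u θ X : ℚ
      u = + 1 ℚ./ L
      θ = + r ℚ./ r ℕ.^ κ
      X = ι r ℚ.* (ι order ℚ.* q) ^ℚ κ

      0<u : 0ℚ ℚ.< u
      0<u = 1/ι>0 L

      X-deficit<X : X ℚ.- deficit ℚ.< X
      X-deficit<X = subst (X ℚ.- deficit ℚ.<_) (ℚ.+-identityʳ X)
        (ℚ.+-monoʳ-< X (ℚ.neg-antimono-< 0<deficit))

      order*μ : ι order ℚ.* (u ℚ.* sumℚ colorSum) ≡ u ℚ.* (X ℚ.- deficit)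
      order*μ = trans
        (solve 3 (λ o u s → o :* (u :* s) := u :* (o :* s)) refl (ι order) u (sumℚ colorSum))
        (cong (u ℚ.*_) order*sum-colorSum)

      1^ : ∀ k → 1ℚ ^ℚ k ≡ 1ℚ
      1^ zero    = refl
      1^ (suc k) = trans (ℚ.*-identityˡ (1ℚ ^ℚ k)) (1^ k)

      -- Multiplying by `(q ℚ.* ι r) ^ℚ κ`, which is 1, clears the denominator of `θ`.
      θ≡r*q^k : θ ≡ ι r ℚ.* q ^ℚ κ
      θ≡r*q^k = begin
        θ                                       ≡⟨ ℚ.*-identityʳ θ ⟨
        θ ℚ.* 1ℚ                                ≡⟨ cong (θ ℚ.*_) (trans (cong (_^ℚ κ) q*r≡1) (1^ κ)) ⟨
        θ ℚ.* (q ℚ.* ι r) ^ℚ κ                  ≡⟨ cong (θ ℚ.*_) (trans (^-distrib-* q (ι r) κ) (cong (q ^ℚ κ ℚ.*_) (sym (ι-^ r κ)))) ⟩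
        θ ℚ.* (q ^ℚ κ ℚ.* ι (r ℕ.^ κ))          ≡⟨ solve 3 (λ x y z → x :* (y :* z) := (x :* z) :* y) refl θ (q ^ℚ κ) (ι (r ℕ.^ κ)) ⟩
        θ ℚ.* ι (r ℕ.^ κ) ℚ.* q ^ℚ κ            ≡⟨ cong (ℚ._* q ^ℚ κ) (p/d*ιd≡ιp r (r ℕ.^ κ)) ⟩
        ι r ℚ.* q ^ℚ κ                          ∎

      -- Inserting `u ℚ.* ι L`, which is 1, brings in the number of solutions; `order*solutions`
      -- then turns it into the power of |G| contained in `X`.
      order*threshold : ι order ℚ.* θ ≡ u ℚ.* X
      order*threshold = begin
        ι order ℚ.* θ
          ≡⟨ cong (ι order ℚ.*_) θ≡r*q^k ⟩
        ι order ℚ.* (ι r ℚ.* q ^ℚ κ)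
          ≡⟨ ℚ.*-identityˡ _ ⟨
        1ℚ ℚ.* (ι order ℚ.* (ι r ℚ.* q ^ℚ κ))
          ≡⟨ cong (ℚ._* (ι order ℚ.* (ι r ℚ.* q ^ℚ κ))) (p/d*ιd≡ιp 1 L) ⟨
        u ℚ.* ι L ℚ.* (ι order ℚ.* (ι r ℚ.* q ^ℚ κ))
          ≡⟨ solve 5 (λ u l o r p → u :* l :* (o :* (r :* p)) := u :* (r :* ((o :* l) :* p)))
               refl u (ι L) (ι order) (ι r) (q ^ℚ κ) ⟩
        u ℚ.* (ι r ℚ.* (ι order ℚ.* ι L ℚ.* q ^ℚ κ))
          ≡⟨ cong (λ y → u ℚ.* (ι r ℚ.* (y ℚ.* q ^ℚ κ))) order*solutions ⟩
        u ℚ.* (ι r ℚ.* (ι order ^ℚ κ ℚ.* q ^ℚ κ))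
          ≡⟨ cong (λ y → u ℚ.* (ι r ℚ.* y)) (^-distrib-* (ι order) q κ) ⟨
        u ℚ.* X ∎

theorem1p1 : ∀ {c ℓ : Level} (G : FiniteAbelianGroup c ℓ) → Nontrivial G →
    (m : ℕ) → m ≥ 1 →
    (a : Vector ℤ (2 *ℕ m +ℕ 1)) → (∀ i → a i ≢ 0ℤ) →
    (∀ i → Coprime (+ FiniteAbelianGroup.order G) (a i)) →
    (r : ℕ) .{{_ : NonZero r}} → r ≥ 3 → Uncommon G a r
theorem1p1 G nontrivial m m≥1 a _ coprime (suc (suc (suc t))) _ =
  let n , order≡2+n = nontrivial⇒order G nontrivial
  in BiasedColoring.uncommon G t n order≡2+n m m≥1 a coprime
theorem1p1 G nontrivial m m≥1 a _ coprime (suc (suc zero)) (s≤s (s≤s ()))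
theorem1p1 G nontrivial m m≥1 a _ coprime (suc zero) (s≤s ())
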